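{- Let $k\in\mathbb{N}$. Each of the languages $L^k$ and $\hat L^k$ can be represented as deterministic parity automata with $2^k$ states (and not less). There exists a deterministic parity automaton for $L^k \cap \hat L^k$ with no more than $2^{4k^2} \cdot k^{2k}$ many states.
   Context: The languages. Let $\Sigma = \{X_1, \ldots, X_k, Y_1, \ldots, Y_k, a_0, \ldots, a_{4k-1}\}$. For $1\le i\le k$ let (as $\omega$-regular expressions) $$L^k_i = ((\Sigma \setminus \{ X_i \}) + X_i (\Sigma \setminus \{ X_i \})^* X_i )^* (a_0 + \ldots + a_{4k-2i+1} )^\omega + \Sigma^* (a_0 + \ldots + a_{4k-2i} )^\omega,$$ $$\hat L^k_i = ((\Sigma \setminus \{ Y_i \}) + Y_i (\Sigma \setminus \{ Y_i \})^* Y_i )^* (a_{2i-2} + \ldots + a_{4k-1} )^\omega + \Sigma^* (a_{2i-1} + \ldots + a_{4k-1} )^\omega.$$ For a falling chain of languages $L_1\supset\cdots\supset L_n$, $\mathcal{L}(L_1,\ldots,L_n)$ is the set of words $w\in\Sigma^\omega$ such that $w\notin L_1$ or the highest $i$ with $w\in L_i$ is even. Set $L^k=\mathcal{L}(L^k_1,\ldots,L^k_k)$ and $\hat L^k=\mathcal{L}(\hat L^k_1,\ldots,\hat L^k_k)$. Automata. A deterministic parity automaton (with transition-based acceptance) is $(Q,\Sigma,\delta,q_0)$ with finite $Q$, initial state $q_0$, and $\delta\subseteq Q\times\Sigma\times Q\times\mathbb{N}$ such that for each $(q,x)\in Q\times\Sigma$ there is exactly one $(q',c)\in Q\times\mathbb{N}$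 with $(q,x,q',c)\in\delta$; $c$ is the color of the transition. A word is accepted if the lowest color occurring infinitely often along its unique run is even. -}

module Defs where

open import Data.Fin.Base as Fin using (Fin; toℕ)
open import Data.List.Base using (List; [_]; _++_; concat; applyUpTo)
open import Data.List.Relation.Unary.All using (All)
open import Data.Nat.Base using (ℕ; zero; suc; _+_; _*_; _∸_; _≤_; _<_)
open import Data.Nat.Divisibility using (_∣_)
open import Data.Product.Base using (∃; ∃₂; _×_; proj₁; proj₂)
open import Data.Sum.Base using (_⊎_)
open import Level using (0ℓ)
open import Relation.Binary.PropositionalEquality using (_≡_)
open import Relation.Nullary.Negation using (¬_)
open import Relation.Unary using (Pred; _∈_; _∉_; _∪_; _≐_; ∁; ｛_｝; U)

Word^ω : Set → Set
Word^ω A = ℕ → A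

Language : Set → Set₁
Language A = Pred (List A) 0ℓ

Language^ω : Set → Set₁
Language^ω A = Pred (Word^ω A) 0ℓ

-- The n-tuple L₁, …, Lₙ is represented as a function on Fin n;
-- Lᵢ is its value at the j with index j ≡ i.
index : ∀ {n} → Fin n → ℕ
index j = suc (toℕ j)

module _ {A : Set} where

  prefix : ℕ → Word^ω A → List A
  prefix n w = applyUpTo w n

  suffix : ℕ → Word^ω A → Word^ω A
  suffix n w m = w (n + m)

  -- The letters of w at the positions p with m ≤ p < n.
  factor : ℕ → ℕ → Word^ω A → List A
  factor m n w = prefix (n ∸ m) (suffix m w)

  infixr 8 _·_ _·ω_
  infix  9 _⋆ _^ω

  letters : Pred A 0ℓ → Language A
  letters P u = ∃ λ x → x ∈ P × u ≡ [ x ]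

  _·_ : Language A → Language A → Language A
  (K · M) w = ∃₂ λ u v → u ∈ K × v ∈ M × w ≡ u ++ v

  _⋆ : Language A → Language A
  (K ⋆) w = ∃ λ us → All K us × w ≡ concat us

  _·ω_ : Language A → Language^ω A → Language^ω A
  (K ·ω M) w = ∃ λ n → prefix n w ∈ K × suffix n w ∈ M

  -- Infinite concatenations of nonempty words of K; the factors are delimited
  -- by the positions cut 0 < cut 1 < ….
  _^ω : Language A → Language^ω A
  (K ^ω) w = ∃ λ (cut : ℕ → ℕ) →
    cut 0 ≡ 0 ×
    (∀ n → cut n < cut (suc n)) ×
    (∀ n → factor (cut n) (cut (suc n)) w ∈ K)

  𝓛 : ∀ {n} → (Fin n → Language^ω A) → Language^ω A
  𝓛 L w =
    (∀ i → index i ≡ 1 → w ∉ L i) ⊎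
    (∃ λ i → w ∈ L i × (∀ j → i Fin.< j → w ∉ L j) × 2 ∣ index i)

data Letter (k : ℕ) : Set where
  X Y : Fin k → Letter k
  a   : Fin (4 * k) → Letter k

module _ {k : ℕ} where

  infix 10 Σ∖_

  Σ∖_ : Letter k → Language (Letter k)
  Σ∖ x = letters (∁ ｛ x ｝)

  Σ⋆ : Language (Letter k)
  Σ⋆ = letters U ⋆

  -- a_m + ⋯ + a_n
  a[_⋯_] : ℕ → ℕ → Language (Letter k)
  a[ m ⋯ n ] = letters λ x → ∃ λ j → m ≤ toℕ j × toℕ j ≤ n × x ≡ a j

  even : Letter k → Language (Letter k)
  even x = (Σ∖ x ∪ letters ｛ x ｝ · Σ∖ x ⋆ · letters ｛ x ｝) ⋆

  -- No subtraction below truncates, since 1 ≤ i ≤ k.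

  L[_] : Fin k → Language^ω (Letter k)
  L[ j ] = even (X j) ·ω a[ 0 ⋯ 4 * k ∸ 2 * i + 1 ] ^ω
         ∪ Σ⋆ ·ω a[ 0 ⋯ 4 * k ∸ 2 * i ] ^ω
    where i = index j

  L̂[_] : Fin k → Language^ω (Letter k)
  L̂[ j ] = even (Y j) ·ω a[ 2 * i ∸ 2 ⋯ 4 * k ∸ 1 ] ^ω
         ∪ Σ⋆ ·ω a[ 2 * i ∸ 1 ⋯ 4 * k ∸ 1 ] ^ω
    where i = index j

L : (k : ℕ) → Language^ω (Letter k)
L k = 𝓛 (L[_] {k})

L̂ : (k : ℕ) → Language^ω (Letter k)
L̂ k = 𝓛 (L̂[_] {k})

-- Deterministic parity automata with n states. That every (q , x) has exactly
-- one successor and color is expressed by δ being a function.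
record DPA (A : Set) (n : ℕ) : Set where
  field
    init : Fin n
    δ    : Fin n → A → Fin n × ℕ

  -- The state before reading w m, and the color of the transition reading w m.
  state : Word^ω A → ℕ → Fin n
  state w zero    = init
  state w (suc m) = proj₁ (δ (state w m) (w m))

  color : Word^ω A → ℕ → ℕ
  color w m = proj₂ (δ (state w m) (w m))

  InfinitelyOften : Word^ω A → ℕ → Set
  InfinitelyOften w c = ∀ m → ∃ λ p → m ≤ p × color w p ≡ c

  Accepted : Language^ω A
  Accepted w = ∃ λ c →
    InfinitelyOften w c × (∀ d → d < c → ¬ InfinitelyOften w d) × 2 ∣ c

infix 4 _Recognizes_

_Recognizes_ : ∀ {A n} → DPA A n → Language^ω A → Set
𝒜 Recognizes M = DPA.Accepted 𝒜 ≐ M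

{-# OPTIONS --safe #-}
-- A word lies in the i-th language of a chain iff from some point on every letter
-- lies in A i, or lies in E i while the number of X_i (Y_i) read is even. Since the
-- chain falls, the indices i for which this holds of one transition form an initial
-- segment; its length is the color, and the k parities are the states.
--
-- For minimality, two parity vectors that differ at i are separated by a letter of
-- E i outside A i repeated forever: i is the highest index containing the word if
-- the i-th parity is even, and i - 1 if it is odd.
--
-- For the intersection, the product automaton remembers for every color c of the
-- first component the least color of the second since c was last seen. If c is the
-- limit inferior of the first color sequence, the values remembered at the visits to
-- c have as limit inferior that of the second.
module Submission where

open import Defs
open import Axiom.ExcludedMiddle using (ExcludedMiddle)
open import Data.Bool.Base using (if_then_else_; true; false)
open import Data.Empty using (⊥-elim)
open import Data.Fin.Base as Fin using (Fin; zero; suc; toℕ; fromℕ<; opposite; combine; remQuot; funToFin; finToFun)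
open import Data.Fin.Patterns using (0F; 1F)
open import Data.Fin.Properties as Fin using (toℕ-fromℕ<; toℕ<n; opposite-involutive; finToFun-funToFin; funToFin-finToFin; remQuot-combine; injective⇒≤)
open import Data.List.Base using (List; []; _∷_; [_]; _++_; _∷ʳ_; concat; foldl; foldr; length; tabulate)
open import Data.List.Properties using (foldr-++; foldr-∷ʳ; foldr-fusion; applyUpTo-∷ʳ; ++-assoc; ∷-injectiveˡ)
open import Data.List.Relation.Unary.All using ([]; _∷_)
open import Data.Nat.Base hiding (parity)
open import Data.Nat.Divisibility using (_∣_; _∣0; _∣?_; ∣-refl; ∣m∣n⇒∣m+n; ∣m+n∣m⇒∣n; ∣n⇒∣m*n; ∣m⇒∣m*n; ∣1⇒≡1)
open import Data.Nat.Properties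
open import Data.Product.Base using (∃; ∃₂; _×_; _,_; proj₁; proj₂)
open import Data.Sum.Base using (_⊎_; inj₁; inj₂)
open import Data.Unit.Base using (tt)
open import Function.Base using (_∘_; const)
open import Function.Bundles using (_⇔_; mk⇔; Equivalence)
open import Level using (0ℓ)
open import Relation.Binary.Definitions using (tri<; tri≈; tri>)
open import Relation.Binary.PropositionalEquality using (_≡_; _≢_; _≗_; refl; sym; trans; cong; cong₂; subst; subst₂; ≢-sym; module ≡-Reasoning)
open import Relation.Nullary using (¬_; Dec; yes; no; does; contradiction)
open import Relation.Nullary.Decidable using (decidable-stable; dec-true; dec-false)
open import Relation.Unary using (Pred; _∈_; _∉_; _∪_; _∩_; _⊆_; U; Decidable)

open Equivalence using (to; from)

-- Limits inferior of sequences of natural numbers.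

Eventually : Pred ℕ 0ℓ → Set
Eventually P = ∃ λ N → ∀ p → N ≤ p → P p

Often : (ℕ → ℕ) → ℕ → Set
Often f c = ∀ m → ∃ λ p → m ≤ p × f p ≡ c

LimInf : (ℕ → ℕ) → ℕ → Set
LimInf f c = Often f c × (∀ d → d < c → ¬ Often f d)

module _ {f : ℕ → ℕ} where

  Eventually-≤⇒LimInf : ∀ {c} → Often f c → Eventually (λ p → c ≤ f p) → LimInf f c
  Eventually-≤⇒LimInf often (N , c≤f) = often , λ d d<c often-d →
    let p , N≤p , fp≡d = often-d N in
    <⇒≱ d<c (subst (_ ≤_) fp≡d (c≤f p N≤p))

  LimInf-unique : ∀ {c d} → LimInf f c → LimInf f d → c ≡ d
  LimInf-unique {c} {d} (oc , lc) (od , ld) =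
    ≤-antisym (≮⇒≥ λ d<c → lc d d<c od) (≮⇒≥ λ c<d → ld c c<d oc)

Eventually-map : ∀ {P Q : Pred ℕ 0ℓ} → (∀ p → P p → Q p) → Eventually P → Eventually Q
Eventually-map P⇒Q (N , P) = N , λ p N≤p → P⇒Q p (P p N≤p)

LimInf-cong : ∀ {f g} → (∀ p → f p ≡ g p) → ∀ {c} → LimInf f c → LimInf g c
LimInf-cong {f} {g} f≡g (often , below) =
  transport f≡g often , λ d d<c → below d d<c ∘ transport (sym ∘ f≡g)
  where
  transport : ∀ {f g} → (∀ p → f p ≡ g p) → ∀ {c} → Often f c → Often g c
  transport f≡g often m with p , m≤p , fp≡c ← often m = p , m≤p , trans (sym (f≡g p)) fp≡c

LimInf-suc : ∀ {f c} → LimInf f c ⇔ LimInf (f ∘ suc) c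
LimInf-suc {f} = mk⇔
  (λ (o , l) → drop o , λ d d<c → l d d<c ∘ undrop)
  (λ (o , l) → undrop o , λ d d<c → l d d<c ∘ drop)
  where
  drop : ∀ {c} → Often f c → Often (f ∘ suc) c
  drop o m with suc p , s≤s m≤p , eq ← o (suc m) = p , m≤p , eq
  undrop : ∀ {c} → Often (f ∘ suc) c → Often f c
  undrop o m with p , m≤p , eq ← o m = suc p , m≤n⇒m≤1+n m≤p , eq

module _ (em : ExcludedMiddle 0ℓ) {f : ℕ → ℕ} where

  ¬Often⇒Eventually-≢ : ∀ {c} → ¬ Often f c → Eventually (λ p → f p ≢ c)
  ¬Often⇒Eventually-≢ ¬often = decidable-stable em λ ¬ev → ¬often λ m →
    decidable-stable em λ ¬found → ¬ev (m , λ p m≤p fp≡c → ¬found (p , m≤p , fp≡c))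

  -- Each value below `c` disappears after some position; the maximum of these finitely many
  -- positions serves them all.
  none-Often⇒Eventually-≤ : ∀ c → (∀ d → d < c → ¬ Often f d) → Eventually (λ p → c ≤ f p)
  none-Often⇒Eventually-≤ zero    _     = 0 , λ _ _ → z≤n
  none-Often⇒Eventually-≤ (suc c) ¬often
    with N , c≤f ← none-Often⇒Eventually-≤ c (λ d d<c → ¬often d (m<n⇒m<1+n d<c))
    with M , f≢c ← ¬Often⇒Eventually-≢ (¬often c ≤-refl)
    = N ⊔ M , λ p N⊔M≤p →
      ≤∧≢⇒< (c≤f p (≤-trans (m≤m⊔n N M) N⊔M≤p)) (≢-sym (f≢c p (≤-trans (m≤n⊔m N M) N⊔M≤p)))

  LimInf⇒Eventually-≤ : ∀ {c} → LimInf f c → Eventually (λ p → c ≤ f p)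
  LimInf⇒Eventually-≤ (_ , below) = none-Often⇒Eventually-≤ _ below

  LimInf-exists : ∀ {b} → (∀ p → f p ≤ b) → ∃ λ c → c ≤ b × LimInf f c
  LimInf-exists {b} f≤b with search (suc b)
    where
    search : ∀ n → (∃ λ c → c < n × LimInf f c) ⊎ (∀ d → d < n → ¬ Often f d)
    search zero    = inj₂ λ _ ()
    search (suc n) with search n
    ... | inj₁ (c , c<n , lim) = inj₁ (c , m<n⇒m<1+n c<n , lim)
    ... | inj₂ none with em {Often f n}
    ...   | yes often = inj₁ (n , ≤-refl , often , none)
    ...   | no ¬often = inj₂ λ d d<1+n → case d d<1+n
      where
      case : ∀ d → d < suc n → ¬ Often f d
      case d d<1+n with m≤n⇒m<n∨m≡n (s≤s⁻¹ d<1+n)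
      ... | inj₁ d<n  = none d d<n
      ... | inj₂ refl = ¬often
  ... | inj₁ (c , c<1+b , lim) = c , s≤s⁻¹ c<1+b , lim
  -- If no value up to `b` recurs, `f` eventually exceeds its bound.
  ... | inj₂ none with N , b<f ← none-Often⇒Eventually-≤ (suc b) none =
    contradiction (b<f N ≤-refl) (≤⇒≯ (f≤b N))

  -- Infinitely many positions attain `c` and almost all are at least `c`, so an eventual lower
  -- bound on the colors becomes a comparison with one number.
  Eventually-≤⇔≤-LimInf : ∀ {c i} → LimInf f c → Eventually (λ p → i ≤ f p) ⇔ i ≤ c
  Eventually-≤⇔≤-LimInf {c} {i} lim@(often , _) = mk⇔
    (λ (N , i≤f) → let p , N≤p , fp≡c = often N in subst (i ≤_) fp≡c (i≤f p N≤p))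
    (λ i≤c → Eventually-map (λ _ → ≤-trans i≤c) (LimInf⇒Eventually-≤ lim))

-- Evenness, and membership in the language of a chain.

2∤1 : ¬ 2 ∣ 1
2∤1 2∣1 with () ← ∣1⇒≡1 2∣1

2∣∨2∣suc : ∀ n → 2 ∣ n ⊎ 2 ∣ suc n
2∣∨2∣suc zero    = inj₁ (2 ∣0)
2∣∨2∣suc (suc n) with 2∣∨2∣suc n
... | inj₁ 2∣n   = inj₂ (∣m∣n⇒∣m+n ∣-refl 2∣n)
... | inj₂ 2∣1+n = inj₁ 2∣1+n

-- One of two consecutive numbers is even; if both were, so would be their difference 1. Minimality
-- rests on this contradiction.
2∣-alternates : ∀ {n} → ¬ (2 ∣ n ⇔ 2 ∣ suc n)
2∣-alternates {n} eqv = 2∤1 (∣m+n∣m⇒∣n (subst (2 ∣_) (+-comm 1 n) both₂) both₁)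
  where
  either : 2 ∣ n × 2 ∣ suc n
  either with 2∣∨2∣suc n
  ... | inj₁ 2∣n   = 2∣n , to eqv 2∣n
  ... | inj₂ 2∣1+n = from eqv 2∣1+n , 2∣1+n
  both₁ = proj₁ either
  both₂ = proj₂ either

-- The highest index of a language containing `w` is `c`; for `c = 0` there is none, and 0 is even.
-- Evenness of `c` thus covers both clauses of `𝓛`.
∈-𝓛⇔ : ∀ {A : Set} {k c w} (K : Fin k → Language^ω A) → c ≤ k →
       (∀ i → w ∈ K i ⇔ index i ≤ c) → w ∈ 𝓛 K ⇔ 2 ∣ c
∈-𝓛⇔ {k = k} {c} {w} K c≤k K⇔ = mk⇔ fwd (bwd c refl)
  where
  -- `k` and `c` are generalized: matching on `c ≤ k` then shows that `Fin k` has a first element.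
  none⇒c≡0 : ∀ {k c} (K : Fin k → Language^ω _) → c ≤ k → (∀ i → w ∈ K i ⇔ index i ≤ c) →
             (∀ i → index i ≡ 1 → w ∉ K i) → c ≡ 0
  none⇒c≡0 {c = zero}  _ _       _  _    = refl
  none⇒c≡0 {c = suc _} _ (s≤s _) K⇔ none = contradiction (from (K⇔ zero) (s≤s z≤n)) (none zero refl)
  fwd : w ∈ 𝓛 K → 2 ∣ c
  fwd (inj₁ none) = subst (2 ∣_) (sym (none⇒c≡0 K c≤k K⇔ none)) (2 ∣0)
  fwd (inj₂ (i , w∈Ki , above , 2∣i)) with m≤n⇒m<n∨m≡n (to (K⇔ i) w∈Ki)
  ... | inj₂ i≡c = subst (2 ∣_) i≡c 2∣i
  -- The next index would still be at most `c`, against the maximality of `i`.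
  ... | inj₁ i<c = contradiction
      (from (K⇔ next) (subst (_≤ c) (cong suc (sym (toℕ-fromℕ< i<k))) i<c))
      (above next (subst (suc (toℕ i) ≤_) (sym (toℕ-fromℕ< i<k)) ≤-refl))
    where
    i<k : suc (toℕ i) < k
    i<k = ≤-trans i<c c≤k
    next = fromℕ< i<k
  bwd : ∀ d → d ≡ c → 2 ∣ c → w ∈ 𝓛 K
  bwd zero    refl _   = inj₁ λ i _ w∈Ki → contradiction (to (K⇔ i) w∈Ki) λ ()
  bwd (suc d) refl 2∣c = inj₂
    ( top , from (K⇔ top) (≤-reflexive (cong suc top≡d))
    , (λ j top<j w∈Kj → <⇒≱ (s≤s top<j) (subst (suc (toℕ j) ≤_) (cong suc (sym top≡d)) (to (K⇔ j) w∈Kj)))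
    , subst (2 ∣_) (cong suc (sym top≡d)) 2∣c)
    where
    top = fromℕ< c≤k
    top≡d : toℕ top ≡ d
    top≡d = toℕ-fromℕ< c≤k

-- Infinite words, and runs after a finite prefix.

prefix≡[x]⇒1 : ∀ {A : Set} n {w : Word^ω A} {x} → prefix n w ≡ [ x ] → n ≡ 1
prefix≡[x]⇒1 1 _ = refl

module _ {A : Set} where

  ⋆-++ : ∀ {K : Language A} {u v} → u ∈ K → v ∈ K ⋆ → u ++ v ∈ K ⋆
  ⋆-++ {u = u} u∈K (us , us∈K , refl) = u ∷ us , u∈K ∷ us∈K , refl

  ∈-letters-U-⋆ : ∀ (u : List A) → u ∈ letters U ⋆
  ∈-letters-U-⋆ []      = [] , [] , refl
  ∈-letters-U-⋆ (x ∷ u) = ⋆-++ (x , tt , refl) (∈-letters-U-⋆ u)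

  -- Every factor is a single letter, which forces `cut m ≡ m`.
  ∈-letters-^ω⇔ : ∀ {P : Pred A 0ℓ} {w} → w ∈ letters P ^ω ⇔ (∀ m → w m ∈ P)
  ∈-letters-^ω⇔ {P} {w} = mk⇔ fwd bwd
    where
    fwd : w ∈ letters P ^ω → ∀ m → w m ∈ P
    fwd (cut , cut0≡0 , cut-< , factors) m with factors m
    ... | x , x∈P , eq = subst P (sym (head (cut-suc m) eq)) x∈P
      where
      cut-step : ∀ m → cut (suc m) ∸ cut m ≡ 1
      cut-step m with y , _ , eq ← factors m = prefix≡[x]⇒1 _ eq
      cut-suc : ∀ m → cut m ≡ m
      cut-suc zero    = cut0≡0
      cut-suc (suc m) = trans (sym (m∸n+n≡m (<⇒≤ (cut-< m)))) (cong₂ _+_ (cut-step m) (cut-suc m))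
      head : cut m ≡ m → factor (cut m) (cut (suc m)) w ≡ [ x ] → w m ≡ x
      head cm eq rewrite cut-step m | cm | +-identityʳ m = ∷-injectiveˡ eq
    bwd : (∀ m → w m ∈ P) → w ∈ letters P ^ω
    bwd w∈P = (λ n → n) , refl , (λ n → ≤-refl) , λ n → w n , w∈P n , single n
      where
      single : ∀ n → factor n (suc n) w ≡ [ w n ]
      single n rewrite m+n∸n≡m 1 n | +-identityʳ n = refl

  stable : ∀ {g : ℕ → A} {N} → (∀ p → N ≤ p → g (suc p) ≡ g p) → ∀ p → N ≤ p → g p ≡ g N
  stable {g} {N} step p N≤p = go (≤⇒≤′ N≤p)
    where
    go : ∀ {p} → N ≤′ p → g p ≡ g N
    go (≤′-reflexive refl) = refl
    go (≤′-step N≤′p)      = trans (step _ (≤′⇒≤ N≤′p)) (go N≤′p)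

  infixr 5 _▹_

  _▹_ : List A → Word^ω A → Word^ω A
  ([]      ▹ v) m       = v m
  ((x ∷ u) ▹ v) zero    = x
  ((x ∷ u) ▹ v) (suc m) = (u ▹ v) m

  prefix-▹ : ∀ u v → prefix (length u) (u ▹ v) ≡ u
  prefix-▹ []      v = refl
  prefix-▹ (x ∷ u) v = cong (x ∷_) (prefix-▹ u v)

  ▹-const : ∀ u {x} p → length u ≤ p → (u ▹ const x) p ≡ x
  ▹-const []      p       _         = refl
  ▹-const (_ ∷ u) (suc p) (s≤s u≤p) = ▹-const u p u≤p

  open DPA

  Accepted⇔2∣LimInf : ∀ {n} (𝒜 : DPA A n) {w c} → LimInf (color 𝒜 w) c → w ∈ Accepted 𝒜 ⇔ 2 ∣ c
  Accepted⇔2∣LimInf 𝒜 lim@(often , below) = mk⇔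
    (λ (d , often′ , below′ , 2∣d) → subst (2 ∣_) (LimInf-unique (often′ , below′) lim) 2∣d)
    (λ 2∣c → _ , often , below , 2∣c)

  module _ {n} (𝒜 : DPA A n) where

    startingAt : Fin n → DPA A n
    startingAt q = record { init = q ; δ = δ 𝒜 }

    after : Fin n → List A → Fin n
    after = foldl λ q x → proj₁ (δ 𝒜 q x)

    -- `state` recurses at the far end of the run; this peels off the first transition instead.
    state-suc : ∀ q w m → state (startingAt q) w (suc m) ≡
                          state (startingAt (proj₁ (δ 𝒜 q (w 0)))) (w ∘ suc) m
    state-suc q w zero    = refl
    state-suc q w (suc m) = cong (λ q → proj₁ (δ 𝒜 q (w (suc m)))) (state-suc q w m)

    -- A limit inferior ignores the first color, so by induction on `u` only the state reached after
    -- `u` matters. Words reaching one state therefore accept the same continuations.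
    Accepted-▹ : ∀ q u {v} → u ▹ v ∈ Accepted (startingAt q) ⇔ v ∈ Accepted (startingAt (after q u))
    Accepted-▹ q []          = mk⇔ (λ x → x) (λ x → x)
    Accepted-▹ q (x ∷ u) {v} = mk⇔
      (λ (c , o , b , 2∣c) → to ih
        (from (Accepted⇔2∣LimInf (startingAt q′) (LimInf-cong color-suc (to LimInf-suc (o , b)))) 2∣c))
      (λ acc → let c , o , b , 2∣c = from ih acc in
        from (Accepted⇔2∣LimInf (startingAt q) (from LimInf-suc (LimInf-cong (sym ∘ color-suc) (o , b)))) 2∣c)
      where
      q′ = proj₁ (δ 𝒜 q x)
      ih = Accepted-▹ q′ u {v}
      color-suc : ∀ m → color (startingAt q) ((x ∷ u) ▹ v) (suc m) ≡ color (startingAt q′) (u ▹ v) m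
      color-suc m = cong (λ q → proj₂ (δ 𝒜 q ((u ▹ v) m))) (state-suc q ((x ∷ u) ▹ v) m)

-- Initial segments and bit vectors.

initial : ∀ {k} {P : Pred (Fin k) 0ℓ} → Decidable P → ℕ
initial {zero}  P? = 0
initial {suc _} P? = if does (P? zero) then suc (initial (P? ∘ suc)) else 0

initial≤ : ∀ {k} {P : Pred (Fin k) 0ℓ} (P? : Decidable P) → initial P? ≤ k
initial≤ {zero}  P? = z≤n
initial≤ {suc _} P? with P? zero
... | yes _ = s≤s (initial≤ (P? ∘ suc))
... | no  _ = z≤n

-- A downward closed subset of `Fin k` is determined by its size, which is how one color carries `k`
-- conditions.
initial⇔ : ∀ {k} {P : Pred (Fin k) 0ℓ} (P? : Decidable P) →
           (∀ {i j} → i Fin.< j → P j → P i) → ∀ i → P i ⇔ index i ≤ initial P?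
initial⇔ {suc k} {P} P? closed i with P? zero
... | no ¬P0 = mk⇔ (λ Pi → contradiction (P0 i Pi) ¬P0) λ ()
  where
  P0 : ∀ i → P i → P zero
  P0 zero    P0 = P0
  P0 (suc i) Pi = closed (s≤s z≤n) Pi
initial⇔ {suc k} P? closed zero | yes P0 = mk⇔ (const (s≤s z≤n)) (const P0)
initial⇔ {suc k} P? closed (suc i) | yes P0 = mk⇔ (s≤s ∘ to ih) (from ih ∘ s≤s⁻¹)
  where ih = initial⇔ (P? ∘ suc) (closed ∘ s≤s) i

funToFin-cong : ∀ {m n} {f g : Fin m → Fin n} → f ≗ g → funToFin f ≡ funToFin g
funToFin-cong {zero}  f≗g = refl
funToFin-cong {suc m} f≗g = cong₂ combine (f≗g zero) (funToFin-cong (f≗g ∘ suc))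

finToFun-injective : ∀ {m n} {p q : Fin (n ^ m)} → finToFun {n} {m} p ≗ finToFun q → p ≡ q
finToFun-injective {m} {n} {p} {q} p≗q =
  trans (sym (funToFin-finToFin {m} {n} p)) (trans (funToFin-cong p≗q) (funToFin-finToFin {m} {n} q))

-- Counting a letter modulo two.

module Parity (em : ExcludedMiddle 0ℓ) {k : ℕ} (x : Letter k) where
  open ≡-Reasoning

  toggle : Letter k → Fin 2 → Fin 2
  toggle y b = if does (em {x ≡ y}) then opposite b else b

  toggle-≡ : ∀ b → toggle x b ≡ opposite b
  toggle-≡ b with em {x ≡ x}
  ... | yes _  = refl
  ... | no x≢x = contradiction refl x≢x

  toggle-≢ : ∀ {y} → x ≢ y → ∀ b → toggle y b ≡ b
  toggle-≢ {y} x≢y b with em {x ≡ y}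
  ... | yes x≡y = contradiction x≡y x≢y
  ... | no _    = refl

  toggle-comm : ∀ y z b → toggle y (toggle z b) ≡ toggle z (toggle y b)
  toggle-comm y z b with em {x ≡ y} | em {x ≡ z}
  ... | yes _ | yes _ = refl
  ... | yes _ | no _  = refl
  ... | no _  | yes _ = refl
  ... | no _  | no _  = refl

  parity : List (Letter k) → Fin 2
  parity = foldr toggle 0F

  -- The fold meets the last letter first. Toggles commute, so the toggle of `y` can be carried from
  -- the inner end to the outer one.
  parity-∷ʳ : ∀ u y → parity (u ∷ʳ y) ≡ toggle y (parity u)
  parity-∷ʳ u y = trans (foldr-∷ʳ toggle 0F y u)
    (sym (foldr-fusion (toggle y) 0F (toggle-comm y) u))

  parity-prefix-suc : ∀ p w → parity (prefix (suc p) w) ≡ toggle (w p) (parity (prefix p w))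
  parity-prefix-suc p w =
    trans (cong parity (sym (applyUpTo-∷ʳ w p))) (parity-∷ʳ (prefix p w) (w p))

  parity-prefix-stable : ∀ {w N} → (∀ p → N ≤ p → x ≢ w p) →
                         ∀ p → N ≤ p → parity (prefix p w) ≡ parity (prefix N w)
  parity-prefix-stable {w} x∉w = stable λ p N≤p →
    trans (parity-prefix-suc p w) (toggle-≢ (x∉w p N≤p) _)

  -- The start bit is arbitrary because, in a block delimited by two `x`, the fold enters the middle
  -- with the bit already flipped.
  Neutral : Language (Letter k)
  Neutral u = ∀ b → foldr toggle b u ≡ b

  ++-neutral : ∀ {u v} → Neutral u → Neutral v → Neutral (u ++ v)
  ++-neutral {u} {v} nu nv b = trans (foldr-++ toggle b u v) (trans (cong (λ b → foldr toggle b u) (nv b)) (nu b))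

  ⋆-neutral : ∀ {K} → K ⊆ Neutral → K ⋆ ⊆ Neutral
  ⋆-neutral K⊆ (_ , []           , refl) b = refl
  ⋆-neutral K⊆ (u ∷ us , u∈K ∷ us∈K , refl) =
    ++-neutral {u} {concat us} (K⊆ u∈K) (⋆-neutral K⊆ (us , us∈K , refl))

  Σ∖-neutral : Σ∖ x ⊆ Neutral
  Σ∖-neutral (y , x≢y , refl) = toggle-≢ x≢y

  even-neutral : even x ⊆ Neutral
  even-neutral = ⋆-neutral λ where
    (inj₁ u∈Σ∖x) → Σ∖-neutral u∈Σ∖x
    (inj₂ (_ , _ , (_ , refl , refl) , (p , _ , p∈Σ∖x⋆ , (_ , refl , refl) , refl) , refl)) b → begin
      toggle x (foldr toggle b (p ∷ʳ x))  ≡⟨ cong (toggle x) (foldr-∷ʳ toggle b x p) ⟩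
      toggle x (foldr toggle (toggle x b) p) ≡⟨ cong (toggle x) (⋆-neutral Σ∖-neutral p∈Σ∖x⋆ _) ⟩
      toggle x (toggle x b)               ≡⟨ toggle-≡ _ ⟩
      opposite (toggle x b)               ≡⟨ cong opposite (toggle-≡ b) ⟩
      opposite (opposite b)               ≡⟨ opposite-involutive b ⟩
      b                                   ∎

  -- The odd case is carried along for the induction: a word of odd parity is split at its first
  -- `x`, and one more `x` in front closes the block.
  split : ∀ u → (parity u ≡ 0F → u ∈ even x) ×
                (parity u ≡ 1F → ∃₂ λ p v → p ∈ Σ∖ x ⋆ × v ∈ even x × u ≡ p ++ x ∷ v)
  split []      = (λ _ → [] , [] , refl) , λ ()
  split (y ∷ u) with em {x ≡ y} | parity u | split u
  -- The new `x` is itself the first one, so `p` is empty.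
  ... | yes refl | 0F | u-even , _ = (λ ()) , λ _ → [] , u , ([] , [] , refl) , u-even refl , refl
  ... | yes refl | 1F | _ , u-odd  with p , v , p∈Σ∖x⋆ , v∈even , refl ← u-odd refl =
    (λ _ → subst (_∈ even x) (cong (x ∷_) (++-assoc p [ x ] v)) (⋆-++
      (inj₂ ([ x ] , p ∷ʳ x , (x , refl , refl) , (p , [ x ] , p∈Σ∖x⋆ , (x , refl , refl) , refl) , refl))
      v∈even)) , λ ()
  ... | no x≢y   | 0F | u-even , _ = (λ _ → ⋆-++ (inj₁ (y , x≢y , refl)) (u-even refl)) , λ ()
  ... | no x≢y   | 1F | _ , u-odd  with p , v , p∈Σ∖x⋆ , v∈even , refl ← u-odd refl =
    (λ ()) , λ _ → y ∷ p , v , ⋆-++ (y , x≢y , refl) p∈Σ∖x⋆ , v∈even , refl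

  ∈-even⇔ : ∀ {u} → u ∈ even x ⇔ parity u ≡ 0F
  ∈-even⇔ {u} = mk⇔ (λ u∈even → even-neutral u∈even 0F) (proj₁ (split u))

  parity-avoiding : ∀ {m} (f : Fin m → Letter k) → (∀ i → x ≢ f i) → parity (tabulate f) ≡ 0F
  parity-avoiding {zero}  f x∉f = refl
  parity-avoiding {suc m} f x∉f =
    trans (toggle-≢ (x∉f 0F) _) (parity-avoiding (f ∘ suc) (x∉f ∘ suc))

  parity-tabulate : ∀ {m} (f : Fin m → Letter k) i → (∀ j → j ≢ i → x ≢ f j) →
                    parity (tabulate f) ≡ toggle (f i) 0F
  parity-tabulate f zero    x∉f = cong (toggle (f 0F)) (parity-avoiding (f ∘ suc) λ j → x∉f (suc j) λ ())
  parity-tabulate f (suc i) x∉f = trans (toggle-≢ (x∉f 0F λ ()) _)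
    (parity-tabulate (f ∘ suc) i λ j j≢i → x∉f (suc j) (j≢i ∘ Fin.suc-injective))

-- The automaton of a chain and its minimality.

module Chain
  (em : ExcludedMiddle 0ℓ) {k : ℕ}
  (Z : Fin k → Letter k) (E A : Fin k → Pred (Letter k) 0ℓ)
  (Z-injective : ∀ {i j} → Z i ≡ Z j → i ≡ j)
  (A⊆E : ∀ i → A i ⊆ E i) (E⊆A : ∀ {i j} → i Fin.< j → E j ⊆ A i)
  (Z∉E : ∀ i j → Z i ∉ E j) (E⊈A : ∀ i → ∃ λ x → x ∈ E i × x ∉ A i)
  where

  private module P i = Parity em (Z i)
  open P

  K : Fin k → Language^ω (Letter k)
  K j = even (Z j) ·ω letters (E j) ^ω ∪ Σ⋆ ·ω letters (A j) ^ω

  Good : Fin k → Fin 2 → Pred (Letter k) 0ℓ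
  Good i b x = x ∈ A i ⊎ (b ≡ 0F × x ∈ E i)

  Good⇒E : ∀ {i b x} → Good i b x → x ∈ E i
  Good⇒E (inj₁ x∈A)       = A⊆E _ x∈A
  Good⇒E (inj₂ (_ , x∈E)) = x∈E

  ∈-K⇔ : ∀ {i w} → w ∈ K i ⇔ Eventually (λ p → Good i (parity i (prefix p w)) (w p))
  ∈-K⇔ {i} {w} = mk⇔ fwd bwd
    where
    from-suffix : ∀ {P n} → suffix n w ∈ letters P ^ω → ∀ p → n ≤ p → w p ∈ P
    from-suffix {P} {n} ∈P p n≤p = subst (λ p → P (w p)) (m+[n∸m]≡n n≤p) (to (∈-letters-^ω⇔ {w = suffix n w}) ∈P _)

    fwd : w ∈ K i → _
    fwd (inj₁ (n , n-even , ∈E)) = n , λ p n≤p → inj₂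
      ( trans (parity-prefix-stable i (λ q n≤q Z≡ → Z∉E i i (subst (E i) (sym Z≡) (from-suffix ∈E q n≤q))) p n≤p)
              (to (∈-even⇔ i) n-even)
      , from-suffix ∈E p n≤p)
    fwd (inj₂ (n , _ , ∈A)) = n , λ p n≤p → inj₁ (from-suffix ∈A p n≤p)

    bwd : Eventually (λ p → Good i (parity i (prefix p w)) (w p)) → w ∈ K i
    bwd (N , good) with parity i (prefix N w) in eq
    ... | 0F = inj₁ (N , from (∈-even⇔ i) eq , from ∈-letters-^ω⇔ λ m → Good⇒E (good _ (m≤m+n N m)))
    ... | 1F = inj₂ (N , ∈-letters-U-⋆ _ , from ∈-letters-^ω⇔ λ m → ∈A m (good _ (m≤m+n N m)))
      where
      odd : ∀ p → N ≤ p → parity i (prefix p w) ≡ 1F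
      odd p N≤p = trans (parity-prefix-stable i (λ q N≤q Z≡ → Z∉E i i (subst (E i) (sym Z≡) (Good⇒E (good q N≤q)))) p N≤p) eq
      ∈A : ∀ m → Good i (parity i (prefix (N + m) w)) (w (N + m)) → w (N + m) ∈ A i
      ∈A m (inj₁ ∈A)       = ∈A
      ∈A m (inj₂ (≡0 , _)) with () ← trans (sym ≡0) (odd _ (m≤m+n N m))

  bits : Fin (2 ^ k) → Fin k → Fin 2
  bits = finToFun

  good? : ∀ s x → Decidable (λ i → Good i (bits s i) x)
  good? s x i = em

  𝒞 : DPA (Letter k) (2 ^ k)
  𝒞 = record
    { init = funToFin {k} (const 0F)
    ; δ    = λ s x → funToFin (λ i → toggle i x (bits s i)) , initial (good? s x)
    }

  open DPA

  bits-state : ∀ w p i → bits (state 𝒞 w p) i ≡ parity i (prefix p w)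
  bits-state w zero    i = finToFun-funToFin {k} (const 0F) i
  bits-state w (suc p) i = begin
    bits (state 𝒞 w (suc p)) i                 ≡⟨ finToFun-funToFin (λ i → toggle i (w p) (bits (state 𝒞 w p) i)) i ⟩
    toggle i (w p) (bits (state 𝒞 w p) i)      ≡⟨ cong (toggle i (w p)) (bits-state w p i) ⟩
    toggle i (w p) (parity i (prefix p w))     ≡⟨ sym (parity-prefix-suc i p w) ⟩
    parity i (prefix (suc p) w)                ∎
    where open ≡-Reasoning

  color≤k : ∀ s x → proj₂ (δ 𝒞 s x) ≤ k
  color≤k s x = initial≤ (good? s x)

  ∈-K⇔color : ∀ {i w} → w ∈ K i ⇔ Eventually (λ p → index i ≤ color 𝒞 w p)
  ∈-K⇔color {i} {w} = mk⇔
    (Eventually-map (λ p → to (good⇔ p) ∘ subst (λ b → Good i b (w p)) (sym (bits-state w p i))) ∘ to ∈-K⇔)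
    (from ∈-K⇔ ∘ Eventually-map λ p → subst (λ b → Good i b (w p)) (bits-state w p i) ∘ from (good⇔ p))
    where
    good⇔ : ∀ p → Good i (bits (state 𝒞 w p) i) (w p) ⇔ index i ≤ color 𝒞 w p
    -- The good indices are downward closed: a letter good for `j` lies in `E j`, hence in `A i` for
    -- every `i` below `j`.
    good⇔ p = initial⇔ (good? (state 𝒞 w p) (w p)) (λ i<j → inj₁ ∘ E⊆A i<j ∘ Good⇒E) i

  -- With `c` the limit inferior of the colors, `w` lies in exactly the `K i` with `index i ≤ c`;
  -- acceptance and membership in `𝓛 K` then both amount to evenness of `c`.
  recognizes : 𝒞 Recognizes 𝓛 K
  recognizes = (λ {w} → to (accepted⇔ w)) , λ {w} → from (accepted⇔ w)
    where
    bounded : ∀ w p → color 𝒞 w p ≤ k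
    bounded w p = color≤k _ (w p)
    member : ∀ {w c} → c ≤ k → LimInf (color 𝒞 w) c → w ∈ 𝓛 K ⇔ 2 ∣ c
    member c≤k lim = ∈-𝓛⇔ K c≤k λ i → mk⇔
      (to (Eventually-≤⇔≤-LimInf em lim) ∘ to ∈-K⇔color)
      (from ∈-K⇔color ∘ from (Eventually-≤⇔≤-LimInf em lim))
    accepted⇔ : ∀ w → w ∈ Accepted 𝒞 ⇔ w ∈ 𝓛 K
    accepted⇔ w = let c , c≤k , lim = LimInf-exists em (bounded w) in
      mk⇔ (from (member c≤k lim) ∘ to (Accepted⇔2∣LimInf 𝒞 lim))
          (from (Accepted⇔2∣LimInf 𝒞 lim) ∘ to (member c≤k lim))

  e : Fin k → Letter k
  e i = proj₁ (E⊈A i)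

  Z≢e : ∀ i j → Z i ≢ e j
  Z≢e i j Z≡e = Z∉E i j (subst (E j) (sym Z≡e) (proj₁ (proj₂ (E⊈A j))))

  -- Past `u` neither the parity nor the letter changes, so being good eventually is being good
  -- right after `u`.
  ▹-const∈K⇔ : ∀ u {x i} → Z i ≢ x → u ▹ const x ∈ K i ⇔ Good i (parity i u) x
  ▹-const∈K⇔ u {x} {i} Z≢x = mk⇔
    (λ ∈K → let N , good = to ∈-K⇔ ∈K
                p = N ⊔ length u
                u≤p = m≤n⊔m N (length u)
            in subst₂ (Good i) (parity≡ p u≤p) (▹-const u p u≤p) (good p (m≤m⊔n N _)))
    (λ good → from ∈-K⇔ (length u , λ p u≤p →
      subst₂ (Good i) (sym (parity≡ p u≤p)) (sym (▹-const u p u≤p)) good))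
    where
    parity≡ : ∀ p → length u ≤ p → parity i (prefix p (u ▹ const x)) ≡ parity i u
    parity≡ p u≤p = trans
      (parity-prefix-stable i (λ q u≤q Z≡ → Z≢x (trans Z≡ (▹-const u q u≤q))) p u≤p)
      (cong (parity i) (prefix-▹ u (const x)))

  -- The letter `e i` lies in `A j` for `j` below `i` and outside `E j` for `j` above; at `i` it is
  -- good exactly for even parity. So `toℕ i` indices count always and one more if `b` is 1.
  ▹-e∈𝓛K⇔ : ∀ {u i} → ∀ b → parity i u ≡ opposite b → u ▹ const (e i) ∈ 𝓛 K ⇔ 2 ∣ toℕ b + toℕ i
  ▹-e∈𝓛K⇔ {u} {i} b parity≡ = ∈-𝓛⇔ K (b+i≤k b) λ j → mk⇔
    (λ ∈K → fwd b parity≡ j (to (▹-const∈K⇔ u (Z≢e j i)) ∈K))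
    (λ j≤ → from (▹-const∈K⇔ u (Z≢e j i)) (bwd b parity≡ j j≤))
    where
    e∈E = proj₁ (proj₂ (E⊈A i))
    e∉A = proj₂ (proj₂ (E⊈A i))
    b+i≤k : ∀ b → toℕ b + toℕ i ≤ k
    b+i≤k 0F = <⇒≤ (toℕ<n i)
    b+i≤k 1F = toℕ<n i
    fwd : ∀ b → parity i u ≡ opposite b → ∀ j → Good j (parity j u) (e i) → index j ≤ toℕ b + toℕ i
    fwd b parity≡ j good with Fin.<-cmp j i
    fwd b parity≡ j good | tri< j<i _ _ = ≤-trans j<i (m≤n+m _ (toℕ b))
    fwd b parity≡ j good | tri> _ _ i<j = contradiction (E⊆A i<j (Good⇒E good)) e∉A
    fwd b parity≡ j (inj₁ e∈A) | tri≈ _ refl _ = contradiction e∈A e∉A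
    fwd 0F parity≡ j (inj₂ (≡0 , _)) | tri≈ _ refl _ with () ← trans (sym ≡0) parity≡
    fwd 1F parity≡ j (inj₂ _) | tri≈ _ refl _ = ≤-refl
    bwd : ∀ b → parity i u ≡ opposite b → ∀ j → index j ≤ toℕ b + toℕ i → Good j (parity j u) (e i)
    bwd 0F _       j j<i = inj₁ (E⊆A j<i e∈E)
    bwd 1F parity≡ j j≤i with m≤n⇒m<n∨m≡n (s≤s⁻¹ j≤i)
    ... | inj₁ j<i = inj₁ (E⊆A j<i e∈E)
    ... | inj₂ j≡i with refl ← Fin.toℕ-injective j≡i = inj₂ (parity≡ , e∈E)

  -- The letter e i, which is no Z j, stands for leaving the i-th parity unchanged.
  setter : Fin k → Fin 2 → Letter k
  setter i 0F = e i
  setter i 1F = Z i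

  word : Fin (2 ^ k) → List (Letter k)
  word s = tabulate λ i → setter i (bits s i)

  -- Only the `i`-th letter of the word can be `Z i`, by `Z-injective` and `Z≢e`. Hence every parity
  -- vector is realized.
  parity-word : ∀ s i → parity i (word s) ≡ bits s i
  parity-word s i = trans (parity-tabulate i _ i λ j j≢i → other j (j≢i ∘ sym) (bits s j)) (own (bits s i))
    where
    other : ∀ j → i ≢ j → ∀ b → Z i ≢ setter j b
    other j i≢j 0F = Z≢e i j
    other j i≢j 1F = i≢j ∘ Z-injective
    own : ∀ b → toggle i (setter i b) 0F ≡ b
    own 0F = toggle-≢ i (Z≢e i i) 0F
    own 1F = toggle-≡ i 0F

  -- Sending each parity vector to the state reached by its `word` is injective, since words with a
  -- common state have the same accepted continuations.
  minimal : ∀ n (𝒜 : DPA (Letter k) n) → 𝒜 Recognizes 𝓛 K → 2 ^ k ≤ n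
  minimal n 𝒜 (sound , complete) = injective⇒≤ {f = reach} λ {s} {t} s~t →
    finToFun-injective {k} {2} λ i → bits-agree s t s~t i (bits s i) (bits t i) refl refl
    where
    reach : Fin (2 ^ k) → Fin n
    reach s = after 𝒜 (init 𝒜) (word s)
    transfer : ∀ {s t v} → reach s ≡ reach t → word s ▹ v ∈ 𝓛 K → word t ▹ v ∈ 𝓛 K
    transfer {s} {t} {v} s~t = sound ∘ from (Accepted-▹ 𝒜 _ (word t))
      ∘ subst (λ q → Accepted (startingAt 𝒜 q) v) s~t ∘ to (Accepted-▹ 𝒜 _ (word s)) ∘ complete
    -- Before the tail of `e i`, even parity gives the highest index `suc (toℕ i)` and odd parity
    -- gives `toℕ i`; a common state would make these equally even.
    separated : ∀ s t → reach s ≡ reach t → ∀ i → bits s i ≡ 0F → bits t i ≡ 1F → 2 ∣ toℕ i ⇔ 2 ∣ suc (toℕ i)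
    separated s t s~t i s≡0 t≡1 = mk⇔
      (to s⇔ ∘ transfer (sym s~t) ∘ from t⇔)
      (to t⇔ ∘ transfer s~t ∘ from s⇔)
      where
      s⇔ = ▹-e∈𝓛K⇔ {word s} {i} 1F (trans (parity-word s i) s≡0)
      t⇔ = ▹-e∈𝓛K⇔ {word t} {i} 0F (trans (parity-word t i) t≡1)
    bits-agree : ∀ s t → reach s ≡ reach t → ∀ i b c → bits s i ≡ b → bits t i ≡ c → bits s i ≡ bits t i
    bits-agree s t s~t i 0F 0F s≡ t≡ = trans s≡ (sym t≡)
    bits-agree s t s~t i 1F 1F s≡ t≡ = trans s≡ (sym t≡)
    bits-agree s t s~t i 0F 1F s≡ t≡ = ⊥-elim (2∣-alternates (separated s t s~t i s≡ t≡))
    bits-agree s t s~t i 1F 0F s≡ t≡ = ⊥-elim (2∣-alternates (separated t s (sym s~t) i t≡ s≡))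

-- Junk above b: every n > b is sent to b.
clamp : ∀ b → ℕ → Fin (suc b)
clamp b n = fromℕ< (s≤s (m⊓n≤n n b))

toℕ-clamp : ∀ {b n} → n ≤ b → toℕ (clamp b n) ≡ n
toℕ-clamp {b} {n} n≤b = trans (toℕ-fromℕ< (s≤s (m⊓n≤n n b))) (m≤n⇒m⊓n≡m n≤b)

if-yes : ∀ {P B : Set} (P? : Dec P) {x y : B} → P → (if does P? then x else y) ≡ x
if-yes P? {x} {y} p = cong (if_then x else y) (dec-true P? p)

if-no : ∀ {P B : Set} (P? : Dec P) {x y : B} → ¬ P → (if does P? then x else y) ≡ y
if-no P? {x} {y} ¬p = cong (if_then x else y) (dec-false P? ¬p)

-- The intersection of two parity automata.

module Intersection {A : Set} {m n : ℕ} (𝒜 : DPA A m) (ℬ : DPA A n) (a b : ℕ) where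
  open DPA

  -- Orders the pairs (c , d) with d ≤ b lexicographically, except that an odd c
  -- yields the same odd color for every d.
  pack : ℕ → ℕ → ℕ
  pack c d = c * (2 * suc b) + (if does (2 ∣? c) then d else 1)

  pack-even : ∀ {c} → 2 ∣ c → ∀ d → pack c d ≡ c * (2 * suc b) + d
  pack-even {c} 2∣c d = cong (c * (2 * suc b) +_) (if-yes (2 ∣? c) 2∣c)

  pack-odd : ∀ {c} → ¬ 2 ∣ c → ∀ d → pack c d ≡ c * (2 * suc b) + 1
  pack-odd {c} 2∤c d = cong (c * (2 * suc b) +_) (if-no (2 ∣? c) 2∤c)

  -- The multiplier `2 * suc b` is even, so the low digit alone decides; for odd `c` that digit is
  -- 1.
  2∣pack⇔ : ∀ c d → 2 ∣ pack c d ⇔ (2 ∣ c × 2 ∣ d)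
  2∣pack⇔ c d = mk⇔ (fwd (2 ∣? c)) λ (2∣c , 2∣d) → subst (2 ∣_) (sym (pack-even 2∣c d)) (∣m∣n⇒∣m+n 2∣cW 2∣d)
    where
    2∣cW = ∣n⇒∣m*n c (∣m⇒∣m*n (suc b) ∣-refl)
    fwd : Dec (2 ∣ c) → 2 ∣ pack c d → 2 ∣ c × 2 ∣ d
    fwd (yes 2∣c) 2∣p = 2∣c , ∣m+n∣m⇒∣n (subst (2 ∣_) (pack-even 2∣c d) 2∣p) 2∣cW
    fwd (no 2∤c)  2∣p = contradiction (∣m+n∣m⇒∣n (subst (2 ∣_) (pack-odd 2∤c d) 2∣p) 2∣cW) 2∤1

  pack-mono-≤ : ∀ c {d e} → d ≤ e → pack c d ≤ pack c e
  pack-mono-≤ c {d} {e} d≤e with 2 ∣? c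
  ... | yes 2∣c = subst₂ _≤_ (sym (pack-even 2∣c d)) (sym (pack-even 2∣c e)) (+-monoʳ-≤ _ d≤e)
  ... | no 2∤c  = ≤-reflexive (trans (pack-odd 2∤c d) (sym (pack-odd 2∤c e)))

  -- The low digit never exceeds the multiplier, so it cannot pass the next multiple.
  pack-mono-< : ∀ {c c′ d e} → d ≤ b → c < c′ → pack c d ≤ pack c′ e
  pack-mono-< {c} {c′} {d} {e} d≤b c<c′ = let open ≤-Reasoning in begin
    c * W + (if does (2 ∣? c) then d else 1) ≤⟨ +-monoʳ-≤ (c * W) (digit (does (2 ∣? c))) ⟩
    c * W + W                                ≡⟨ +-comm (c * W) W ⟩
    suc c * W                                ≤⟨ *-monoˡ-≤ W c<c′ ⟩
    c′ * W                                   ≤⟨ m≤m+n (c′ * W) _ ⟩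
    pack c′ e                                ∎
    where
    W = 2 * suc b
    digit : ∀ t → (if t then d else 1) ≤ W
    digit false = s≤s z≤n
    digit true  = ≤-trans d≤b (≤-trans (n≤1+n b) (m≤m+n (suc b) _))

  -- After a visit of `f` to `c`, `mem p c` is the minimum of `b` and the values of `g` read since.
  -- The value of `g` at a visit counts for the period ending there, so the reset leaves it out.
  LimInf-pack : ∀ {f g h : ℕ → ℕ} (mem : ℕ → ℕ → ℕ) {c d} → d ≤ b →
    (∀ p → f p ≡ c → mem (suc p) c ≡ b) →
    (∀ p → f p ≢ c → mem (suc p) c ≡ mem p c ⊓ g p) →
    (∀ p → h p ≡ pack (f p) (mem p (f p) ⊓ g p)) →
    Often f c → Eventually (λ p → c ≤ f p) →
    Often g d → Eventually (λ p → d ≤ g p) →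
    LimInf h (pack c d)
  LimInf-pack {f} {g} {h} mem {c} {d} d≤b reset keep h≡ often-c (N , c≤f) often-d (M , d≤g) =
    Eventually-≤⇒LimInf often (suc p₀ , below)
    where
    -- This visit to `c` lies past both thresholds and erases any smaller value remembered from
    -- before.
    first = often-c (N ⊔ M)
    p₀ = proj₁ first
    N⊔M≤p₀ = proj₁ (proj₂ first)
    N≤ : ∀ {p} → p₀ < p → N ≤ p
    N≤ p₀<p = ≤-trans (m≤m⊔n N M) (≤-trans N⊔M≤p₀ (<⇒≤ p₀<p))
    M≤ : ∀ {p} → p₀ < p → M ≤ p
    M≤ p₀<p = ≤-trans (m≤n⊔m N M) (≤-trans N⊔M≤p₀ (<⇒≤ p₀<p))

    d≤mem′ : ∀ {p} → suc p₀ ≤′ p → d ≤ mem p c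
    d≤mem′ (≤′-reflexive refl) = subst (d ≤_) (sym (reset p₀ (proj₂ (proj₂ first)))) d≤b
    d≤mem′ (≤′-step {p} p₀<p) with f p ≟ c
    ... | yes fp≡c = subst (d ≤_) (sym (reset p fp≡c)) d≤b
    ... | no  fp≢c = subst (d ≤_) (sym (keep p fp≢c)) (⊓-glb (d≤mem′ p₀<p) (d≤g p (M≤ (≤′⇒≤ p₀<p))))

    d≤min : ∀ {p} → p₀ < p → d ≤ mem p c ⊓ g p
    d≤min p₀<p = ⊓-glb (d≤mem′ (≤⇒≤′ p₀<p)) (d≤g _ (M≤ p₀<p))

    at-c : ∀ {p} → f p ≡ c → h p ≡ pack c (mem p c ⊓ g p)
    at-c {p} fp≡c = trans (h≡ p) (cong (λ c → pack c (mem p c ⊓ g p)) fp≡c)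

    below : ∀ p → p₀ < p → pack c d ≤ h p
    below p p₀<p with m≤n⇒m<n∨m≡n (c≤f p (N≤ p₀<p))
    -- A larger color of the first sequence outweighs whatever was remembered.
    ... | inj₁ c<fp = subst (pack c d ≤_) (sym (h≡ p)) (pack-mono-< d≤b c<fp)
    ... | inj₂ c≡fp = subst (pack c d ≤_) (sym (at-c (sym c≡fp))) (pack-mono-≤ c (d≤min p₀<p))

    -- A minimum of at most `d` survives until the first visit to `c` from `p` on; `l` is the
    -- distance to some known visit and bounds the search.
    next-c : ∀ l p → mem p c ⊓ g p ≤ d → f (l + p) ≡ c → ∃ λ q → p ≤ q × f q ≡ c × mem q c ⊓ g q ≤ d
    next-c zero    p min≤d fp≡c = p , ≤-refl , fp≡c , min≤d
    next-c (suc l) p min≤d fp≡c with f p ≟ c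
    ... | yes fp≡c = p , ≤-refl , fp≡c , min≤d
    ... | no  fp≢c
      with q , p<q , rest ← next-c l (suc p)
             (≤-trans (m⊓n≤m _ _) (subst (_≤ d) (sym (keep p fp≢c)) min≤d))
             (trans (cong f (+-suc l p)) fp≡c)
      = q , <⇒≤ p<q , rest

    -- `g` takes the value `d` at `p`, and `r` is the first visit to `c` from there on; `d≤min`
    -- makes the minimum at `r` exactly `d`.
    often : Often h (pack c d)
    often m
      with p , ≤p , gp≡d ← often-d (m ⊔ suc p₀)
      with q , p≤q , fq≡c ← often-c p
      with r , p≤r , fr≡c , min≤d ← next-c (q ∸ p) p (subst (mem p c ⊓ g p ≤_) gp≡d (m⊓n≤n _ _))
             (trans (cong f (m∸n+n≡m p≤q)) fq≡c)
      = r , ≤-trans (m≤m⊔n m _) (≤-trans ≤p p≤r)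
      , trans (at-c fr≡c) (cong (pack c) (≤-antisym min≤d (d≤min (≤-trans (m≤n⊔m m _) (≤-trans ≤p p≤r)))))

  Memory : ℕ
  Memory = suc b ^ suc a

  -- The coding of triples stays opaque: what follows relies on the three decoding equations and
  -- `memory≤b`.
  abstract
    encode : Fin m → Fin n → (Fin (suc a) → Fin (suc b)) → Fin ((m * n) * Memory)
    encode q r f = combine (combine q r) (funToFin f)

    stateᴬ : Fin ((m * n) * Memory) → Fin m
    stateᴬ s = proj₁ (remQuot n (proj₁ (remQuot {m * n} Memory s)))

    stateᴮ : Fin ((m * n) * Memory) → Fin n
    stateᴮ s = proj₂ (remQuot {m} n (proj₁ (remQuot {m * n} Memory s)))

    memory : Fin ((m * n) * Memory) → ℕ → ℕ
    memory s c = toℕ (finToFun {suc b} {suc a} (proj₂ (remQuot {m * n} Memory s)) (clamp a c))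

    memory≤b : ∀ s c → memory s c ≤ b
    memory≤b s c = s≤s⁻¹ (toℕ<n (finToFun {suc b} {suc a} (proj₂ (remQuot {m * n} Memory s)) (clamp a c)))

    stateᴬ-encode : ∀ q r f → stateᴬ (encode q r f) ≡ q
    stateᴬ-encode q r f = trans (cong (proj₁ ∘ remQuot n ∘ proj₁) (remQuot-combine (combine q r) (funToFin f)))
      (cong proj₁ (remQuot-combine q r))

    stateᴮ-encode : ∀ q r f → stateᴮ (encode q r f) ≡ r
    stateᴮ-encode q r f = trans (cong (proj₂ ∘ remQuot {m} n ∘ proj₁) (remQuot-combine (combine q r) (funToFin f)))
      (cong proj₂ (remQuot-combine q r))

    memory-encode : ∀ q r f c → memory (encode q r f) c ≡ toℕ (f (clamp a c))
    memory-encode q r f c = trans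
      (cong (λ s → toℕ (finToFun {suc b} {suc a} (proj₂ s) (clamp a c))) (remQuot-combine (combine q r) (funToFin f)))
      (cong toℕ (finToFun-funToFin f (clamp a c)))

  -- Both branches are at most `b`, the second by `memory≤b`, so `clamp` changes no value.
  update : Fin ((m * n) * Memory) → ℕ → ℕ → Fin (suc a) → Fin (suc b)
  update s c d i = clamp b (if does (toℕ i ≟ c) then b else memory s (toℕ i) ⊓ d)

  𝒫 : DPA A ((m * n) * Memory)
  𝒫 = record
    -- Any initial memory would do, since `LimInf-pack` only looks past a reset.
    { init = encode (init 𝒜) (init ℬ) (const zero)
    ; δ    = λ s x →
        let q , c = δ 𝒜 (stateᴬ s) x
            r , d = δ ℬ (stateᴮ s) x
        in encode q r (update s c d) , pack c (memory s c ⊓ d)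
    }

  updated : Word^ω A → ℕ → Fin (suc a) → Fin (suc b)
  updated w p = update s (proj₂ (δ 𝒜 (stateᴬ s) (w p))) (proj₂ (δ ℬ (stateᴮ s) (w p)))
    where s = state 𝒫 w p

  stateᴬ-state : ∀ w p → stateᴬ (state 𝒫 w p) ≡ state 𝒜 w p
  stateᴬ-state w zero    = stateᴬ-encode _ _ (const zero)
  stateᴬ-state w (suc p) = trans (stateᴬ-encode _ _ (updated w p))
    (cong (λ q → proj₁ (δ 𝒜 q (w p))) (stateᴬ-state w p))

  stateᴮ-state : ∀ w p → stateᴮ (state 𝒫 w p) ≡ state ℬ w p
  stateᴮ-state w zero    = stateᴮ-encode _ _ (const zero)
  stateᴮ-state w (suc p) = trans (stateᴮ-encode _ _ (updated w p))
    (cong (λ q → proj₁ (δ ℬ q (w p))) (stateᴮ-state w p))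

  memory-suc : ∀ w p c → memory (state 𝒫 w (suc p)) c ≡
               toℕ (update (state 𝒫 w p) (color 𝒜 w p) (color ℬ w p) (clamp a c))
  memory-suc w p c = trans (memory-encode _ _ (updated w p) c)
    (cong₂ (λ q r → toℕ (update (state 𝒫 w p) (proj₂ (δ 𝒜 q (w p))) (proj₂ (δ ℬ r (w p))) (clamp a c)))
      (stateᴬ-state w p) (stateᴮ-state w p))

  color-𝒫 : ∀ w p → color 𝒫 w p ≡ pack (color 𝒜 w p) (memory (state 𝒫 w p) (color 𝒜 w p) ⊓ color ℬ w p)
  color-𝒫 w p = cong₂ (λ q r → let c = proj₂ (δ 𝒜 q (w p)) in
      pack c (memory (state 𝒫 w p) c ⊓ proj₂ (δ ℬ r (w p))))
    (stateᴬ-state w p) (stateᴮ-state w p)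

  memory-reset : ∀ w p {c} → c ≤ a → color 𝒜 w p ≡ c → memory (state 𝒫 w (suc p)) c ≡ b
  memory-reset w p {c} c≤a refl = trans (memory-suc w p c) lemma
    where
    lemma : toℕ (update (state 𝒫 w p) c (color ℬ w p) (clamp a c)) ≡ b
    lemma rewrite toℕ-clamp c≤a = trans (cong (toℕ ∘ clamp b) (if-yes (c ≟ c) refl)) (toℕ-clamp ≤-refl)

  memory-keep : ∀ w p {c} → c ≤ a → color 𝒜 w p ≢ c →
                memory (state 𝒫 w (suc p)) c ≡ memory (state 𝒫 w p) c ⊓ color ℬ w p
  memory-keep w p {c} c≤a c′≢c = trans (memory-suc w p c) lemma
    where
    lemma : toℕ (update (state 𝒫 w p) (color 𝒜 w p) (color ℬ w p) (clamp a c)) ≡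
            memory (state 𝒫 w p) c ⊓ color ℬ w p
    lemma rewrite toℕ-clamp c≤a = trans (cong (toℕ ∘ clamp b) (if-no (c ≟ color 𝒜 w p) (c′≢c ∘ sym)))
      (toℕ-clamp (≤-trans (m⊓n≤m _ _) (memory≤b (state 𝒫 w p) c)))

  module _ (em : ExcludedMiddle 0ℓ)
    (color≤a : ∀ q x → proj₂ (δ 𝒜 q x) ≤ a) (color≤b : ∀ q x → proj₂ (δ ℬ q x) ≤ b) where

    LimInf-color : ∀ w {c d} → c ≤ a → d ≤ b → LimInf (color 𝒜 w) c → LimInf (color ℬ w) d →
                   LimInf (color 𝒫 w) (pack c d)
    LimInf-color w c≤a d≤b limᴬ limᴮ = LimInf-pack (memory ∘ state 𝒫 w) d≤b
      (λ p → memory-reset w p c≤a) (λ p → memory-keep w p c≤a) (color-𝒫 w)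
      (proj₁ limᴬ) (LimInf⇒Eventually-≤ em limᴬ) (proj₁ limᴮ) (LimInf⇒Eventually-≤ em limᴮ)

    Accepted-𝒫⇔ : ∀ w → w ∈ Accepted 𝒫 ⇔ (w ∈ Accepted 𝒜 × w ∈ Accepted ℬ)
    Accepted-𝒫⇔ w =
      let c , c≤a , limᴬ = LimInf-exists em λ p → color≤a (state 𝒜 w p) (w p)
          d , d≤b , limᴮ = LimInf-exists em λ p → color≤b (state ℬ w p) (w p)
          eq⇔ = Accepted⇔2∣LimInf 𝒫 (LimInf-color w c≤a d≤b limᴬ limᴮ)
          eqᴬ = Accepted⇔2∣LimInf 𝒜 limᴬ
          eqᴮ = Accepted⇔2∣LimInf ℬ limᴮ
      in mk⇔ (λ acc → let 2∣c , 2∣d = to (2∣pack⇔ c d) (to eq⇔ acc) in from eqᴬ 2∣c , from eqᴮ 2∣d)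
             (λ (accᴬ , accᴮ) → from eq⇔ (from (2∣pack⇔ c d) (to eqᴬ accᴬ , to eqᴮ accᴮ)))

    ∩-recognizes : ∀ {M N} → 𝒜 Recognizes M → ℬ Recognizes N → 𝒫 Recognizes (M ∩ N)
    ∩-recognizes (soundᴬ , completeᴬ) (soundᴮ , completeᴮ) =
      (λ {w} acc → let accᴬ , accᴮ = to (Accepted-𝒫⇔ w) acc in soundᴬ accᴬ , soundᴮ accᴮ) ,
      (λ {w} (w∈M , w∈N) → from (Accepted-𝒫⇔ w) (completeᴬ w∈M , completeᴮ w∈N))

-- The two chains, given by intervals of letters.

-- `letters (Between m n)` unfolds to `a[ m ⋯ n ]`, so the languages `K` of the two instances of
-- `Chain` are definitionally `L[_]` and `L̂[_]`.
Between : ∀ {k} → ℕ → ℕ → Pred (Letter k) 0ℓ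
Between m n x = ∃ λ j → m ≤ toℕ j × toℕ j ≤ n × x ≡ a j

Between-widen : ∀ {k m n m′ n′} → m′ ≤ m → n ≤ n′ → Between {k} m n ⊆ Between m′ n′
Between-widen m′≤m n≤n′ (j , m≤j , j≤n , eq) = j , ≤-trans m′≤m m≤j , ≤-trans j≤n n≤n′ , eq

letter∈Between : ∀ {k m n t} (t<4k : t < 4 * k) → m ≤ t → t ≤ n → a (fromℕ< t<4k) ∈ Between {k} m n
letter∈Between t<4k m≤t t≤n = fromℕ< t<4k
  , subst (_ ≤_) (sym (toℕ-fromℕ< t<4k)) m≤t , subst (_≤ _) (sym (toℕ-fromℕ< t<4k)) t≤n , refl

letter∈Between⁻¹ : ∀ {k m n t} (t<4k : t < 4 * k) → a (fromℕ< t<4k) ∈ Between {k} m n → m ≤ t × t ≤ n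
letter∈Between⁻¹ t<4k (_ , m≤t , t≤n , refl) =
  subst (_ ≤_) (toℕ-fromℕ< t<4k) m≤t , subst (_≤ _) (toℕ-fromℕ< t<4k) t≤n

2*index≤4k : ∀ {k} (i : Fin k) → 2 * index i ≤ 4 * k
2*index≤4k i = *-mono-≤ {2} {4} (s≤s (s≤s z≤n)) (toℕ<n i)

module 𝓧 (em : ExcludedMiddle 0ℓ) (k : ℕ) where

  E A : Fin k → Pred (Letter k) 0ℓ
  E i = Between 0 (4 * k ∸ 2 * index i + 1)
  A i = Between 0 (4 * k ∸ 2 * index i)

  X-injective : ∀ {i j : Fin k} → X i ≡ X j → i ≡ j
  X-injective refl = refl

  A⊆E : ∀ i → A i ⊆ E i
  A⊆E i = Between-widen z≤n (m≤m+n _ 1)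

  -- Upper ends drop by two from one index to the next, while `E` exceeds `A` by only one letter.
  E⊆A : ∀ {i j} → i Fin.< j → E j ⊆ A i
  E⊆A {i} {j} i<j = Between-widen z≤n (subst (_≤ 4 * k ∸ 2 * index i) (+-comm 1 _)
    (∸-monoʳ-< (*-monoʳ-< 2 (s≤s i<j)) (2*index≤4k j)))

  X∉E : ∀ i j → X i ∉ E j
  X∉E _ _ (_ , _ , _ , ())

  E⊈A : ∀ i → ∃ λ x → x ∈ E i × x ∉ A i
  -- The top letter of `E i`, the only one beyond `A i`.
  E⊈A i = a (fromℕ< t<4k) , letter∈Between t<4k z≤n ≤-refl , λ x∈A →
    1+n≰n (subst (_≤ 4 * k ∸ 2 * index i) (+-comm _ 1) (proj₂ (letter∈Between⁻¹ t<4k x∈A)))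
    where
    t<4k : 4 * k ∸ 2 * index i + 1 < 4 * k
    t<4k = subst (4 * k ∸ 2 * index i + 1 <_) (m∸n+n≡m (2*index≤4k i))
      (+-monoʳ-< (4 * k ∸ 2 * index i) (*-monoʳ-≤ 2 (s≤s (z≤n {toℕ i}))))

  open Chain em X E A X-injective A⊆E E⊆A X∉E E⊈A public

module 𝓨 (em : ExcludedMiddle 0ℓ) (k : ℕ) where

  E A : Fin k → Pred (Letter k) 0ℓ
  E i = Between (2 * index i ∸ 2) (4 * k ∸ 1)
  A i = Between (2 * index i ∸ 1) (4 * k ∸ 1)

  2*[1+n]∸2 : ∀ n → 2 * suc n ∸ 2 ≡ 2 * n
  2*[1+n]∸2 n = cong (_∸ 2) (*-suc 2 n)

  2*[1+n]∸1 : ∀ n → 2 * suc n ∸ 1 ≡ suc (2 * n)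
  2*[1+n]∸1 n = cong (_∸ 1) (*-suc 2 n)

  Y-injective : ∀ {i j : Fin k} → Y i ≡ Y j → i ≡ j
  Y-injective refl = refl

  A⊆E : ∀ i → A i ⊆ E i
  A⊆E i = Between-widen (∸-monoʳ-≤ {1} {2} (2 * index i) (s≤s z≤n)) ≤-refl

  -- Here the intervals shrink from below: lower ends rise by two per index, and `E` starts one
  -- letter before `A`.
  E⊆A : ∀ {i j} → i Fin.< j → E j ⊆ A i
  E⊆A {i} {j} i<j = Between-widen
    (subst₂ _≤_ (sym (2*[1+n]∸1 (toℕ i))) (sym (2*[1+n]∸2 (toℕ j))) (*-monoʳ-< 2 i<j)) ≤-refl

  Y∉E : ∀ i j → Y i ∉ E j
  Y∉E _ _ (_ , _ , _ , ())

  E⊈A : ∀ i → ∃ λ x → x ∈ E i × x ∉ A i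
  -- The bottom letter of `E i`, just before `A i` starts.
  E⊈A i = a (fromℕ< t<4k) , letter∈Between t<4k ≤-refl (<⇒≤pred t<4k) , λ x∈A →
    1+n≰n (subst₂ _≤_ (2*[1+n]∸1 (toℕ i)) (2*[1+n]∸2 (toℕ i)) (proj₁ (letter∈Between⁻¹ t<4k x∈A)))
    where
    t<4k : 2 * index i ∸ 2 < 4 * k
    t<4k = subst (_< 4 * k) (sym (2*[1+n]∸2 (toℕ i)))
      (<-≤-trans (*-monoʳ-< 2 (≤-refl {suc (toℕ i)})) (2*index≤4k i))

  open Chain em Y E A Y-injective A⊆E E⊆A Y∉E E⊈A public

-- The number of states.

1+n≤2^n : ∀ n → suc n ≤ 2 ^ n
1+n≤2^n zero    = ≤-refl
1+n≤2^n (suc n) = begin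
  suc (suc n)       ≤⟨ s≤s (m≤n+m (suc n) n) ⟩
  suc n + suc n     ≡⟨ cong (suc n +_) (sym (+-identityʳ (suc n))) ⟩
  2 * suc n         ≤⟨ *-monoʳ-≤ 2 (1+n≤2^n n) ⟩
  2 * 2 ^ n         ∎
  where open ≤-Reasoning

-- Since `suc k ≤ 2 ^ k`, the left side is at most 2 to the power `k + k + k * suc k`, that is,
-- `k * k` plus three times `k`. For positive `k` this exponent is at most `4 * k ^ 2`, and
-- `k ^ (2 * k)` is at least 1.
size-bound : ∀ k → (2 ^ k * 2 ^ k) * suc k ^ suc k ≤ 2 ^ (4 * k ^ 2) * k ^ (2 * k)
-- Both sides are 1, as `0 ^ 0` is 1.
size-bound zero = ≤-refl
size-bound k@(suc _) = begin
  (2 ^ k * 2 ^ k) * suc k ^ suc k   ≤⟨ *-monoʳ-≤ (2 ^ k * 2 ^ k) (^-monoˡ-≤ (suc k) (1+n≤2^n k)) ⟩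
  (2 ^ k * 2 ^ k) * (2 ^ k) ^ suc k ≡⟨ cong₂ _*_ (sym (^-distribˡ-+-* 2 k k)) (^-*-assoc 2 k (suc k)) ⟩
  2 ^ (k + k) * 2 ^ (k * suc k)     ≡⟨ sym (^-distribˡ-+-* 2 (k + k) (k * suc k)) ⟩
  2 ^ (k + k + k * suc k)           ≤⟨ ^-monoʳ-≤ 2 exponent ⟩
  2 ^ (4 * k ^ 2)                   ≤⟨ m≤m*n (2 ^ (4 * k ^ 2)) (k ^ (2 * k)) {{m^n≢0 k (2 * k)}} ⟩
  2 ^ (4 * k ^ 2) * k ^ (2 * k)     ∎
  where
  open ≤-Reasoning
  k≤k*k : k ≤ k * k
  k≤k*k = m≤m*n k k
  exponent : k + k + k * suc k ≤ 4 * k ^ 2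
  exponent = begin
    k + k + k * suc k             ≡⟨ cong (k + k +_) (*-suc k k) ⟩
    k + k + (k + k * k)           ≡⟨ +-assoc k k _ ⟩
    k + (k + (k + k * k))         ≤⟨ +-mono-≤ k≤k*k (+-mono-≤ k≤k*k (+-mono-≤ k≤k*k (m≤m+n (k * k) 0))) ⟩
    4 * (k * k)                   ≡⟨ cong (λ m → 4 * (k * m)) (sym (*-identityʳ k)) ⟩
    4 * k ^ 2                     ∎

proposition5p13 : ExcludedMiddle 0ℓ →
    ∀ (k : ℕ) →
    ((∃ λ (𝒜 : DPA (Letter k) (2 ^ k)) → 𝒜 Recognizes L k) ×
    (∀ n (𝒜 : DPA (Letter k) n) → 𝒜 Recognizes L k → 2 ^ k ≤ n)) ×
    ((∃ λ (𝒜 : DPA (Letter k) (2 ^ k)) → 𝒜 Recognizes L̂ k) ×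
    (∀ n (𝒜 : DPA (Letter k) n) → 𝒜 Recognizes L̂ k → 2 ^ k ≤ n)) ×
    (∃ λ n → n ≤ 2 ^ (4 * k ^ 2) * k ^ (2 * k) ×
    (∃ λ (𝒜 : DPA (Letter k) n) → 𝒜 Recognizes (L k ∩ L̂ k)))
proposition5p13 em k =
  ((𝓧.𝒞 em k , 𝓧.recognizes em k) , 𝓧.minimal em k) ,
  ((𝓨.𝒞 em k , 𝓨.recognizes em k) , 𝓨.minimal em k) ,
  _ , size-bound k , 𝒫 , ∩-recognizes em
    (𝓧.color≤k em k) (𝓨.color≤k em k) (𝓧.recognizes em k) (𝓨.recognizes em k)
  -- Both automata have colors from 0 to `k`, so the memory is a map from `suc k` colors to `suc k`
  -- values.
  where open Intersection (𝓧.𝒞 em k) (𝓨.𝒞 em k) k k
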